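{- Let $P$ be a (disjunctive) logic program and let $G_P$ be its 3-coloured graph encoding. The symmetries of $P$ correspond one-to-one to the symmetries of the coloured graph $G_P$: every symmetry $\sigma$ of $G_P$ induces, through its action on the positive literal vertices, a permutation of $\mathrm{atom}(P)$ which is a symmetry of $P$, and the resulting map from symmetries of $G_P$ to symmetries of $P$ is a bijection.
   Context: A (disjunctive) logic program $P$ over a set $\mathcal{A}$ of atoms is a finite set of rules $r$ of the form $a_1;\ldots;a_\ell \leftarrow b_1,\ldots,b_m,\sim c_1,\ldots,\sim c_n$ with all $a_i,b_j,c_k\in\mathcal{A}$ and $\ell,m,n\ge 0$. A rule is determined by its head $\mathrm{head}(r)=\{a_1,\ldots,a_\ell\}$ and its body $\mathrm{body}(r)=\{b_1,\ldots,b_m,\sim c_1,\ldots,\sim c_n\}$, regarded as sets. Here $\sim$ is default negation (a purely syntactic marker); a default literal is an atom $a$ or $\sim a$. $\mathrm{atom}(P)$ is the set of atoms occurring in $P$. For a permutation $\pi$ of $\mathrm{atom}(P)$, $r^\pi$ is the rule obtained from $r$ by replacing each atom $a$ by $a^\pi=\pi(a)$, and $P^\pi=\{r^\pi\mid r\in P\}$. A symmetry of $P$ is a permutation $\pi$ of $\mathrm{atom}(P)$ with $P^\pi=P$. The 3-coloured graph encoding $G_P$ is the following directed vertex-coloured graph. (1) For each atom $a\in\mathrm{atom}(P)$ there are two vertices: a positive literal vertex $a$ of colour 1 and a negative literal vertex $\sim a$ of colour 2. (2) For each rule $r\in P$ there is a body vertex $\beta_r$ of colour 3, a directed edge from the vertex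 of each literal in $\mathrm{body}(r)$ to $\beta_r$, and a directed edge from $\beta_r$ to the positive literal vertex of each atom in $\mathrm{head}(r)$. (3) For each atom $a\in\mathrm{atom}(P)$ there is a directed edge from vertex $a$ to vertex $\sim a$. A symmetry of a directed coloured graph with vertex set $V$ and edge set $E$ is a permutation $\sigma$ of $V$ such that $(u,v)\in E$ iff $(\sigma(u),\sigma(v))\in E$, and such that $\sigma$ maps each vertex to a vertex of the same colour. -}

module Defs where

open import Data.Fin.Base using (Fin)
open import Data.Fin.Patterns using (0F; 1F; 2F)
open import Data.List.Base using (List)
open import Data.List.Membership.Propositional using (_∈_; mapWith∈)
import Data.List.Membership.Setoid as ∈ₛ
open import Data.List.Relation.Binary.BagAndSetEquality using ([_]-Equality; set)
open import Data.Nat.Base using (ℕ)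
open import Data.Product.Base using (Σ; ∃; _×_; _,_; proj₁; proj₂)
open import Data.Product.Relation.Binary.Pointwise.NonDependent using (×-setoid)
open import Function.Bundles using (Equivalence; Inverse; _⇔_)
open import Level using (Level; suc; _⊔_)
open import Relation.Binary.Bundles using (Setoid)
open import Relation.Binary.Core using (Rel)
open import Relation.Binary.Definitions using (_Respects₂_)
import Relation.Binary.Construct.On as On
open import Relation.Binary.PropositionalEquality as ≡ using (_≡_; refl)

private
  variable
    c ℓ e : Level

------------------------------------------------------------------------
-- Permutations of a setoid, compared pointwise

Permutation : Setoid c ℓ → Set (c ⊔ ℓ)
Permutation S = Inverse S S

permutationSetoid : Setoid c ℓ → Setoid (c ⊔ ℓ) (c ⊔ ℓ)
permutationSetoid S = record
  { Carrier       = Permutation S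
  ; _≈_           = λ σ τ → ∀ x → Inverse.to σ x ≈ Inverse.to τ x
  ; isEquivalence = record
    { refl  = λ _ → S.refl
    ; sym   = λ σ≈τ x → S.sym (σ≈τ x)
    ; trans = λ ρ≈σ σ≈τ x → S.trans (ρ≈σ x) (σ≈τ x)
    }
  }
  where
  module S = Setoid S
  open S using (_≈_)

------------------------------------------------------------------------
-- Directed graphs with vertices coloured by k colours

-- The vertex set is a setoid, i.e. vertices are taken modulo _≈_.

record ColouredGraph (k : ℕ) (c ℓ e : Level) : Set (suc (c ⊔ ℓ ⊔ e)) where
  field
    vertices    : Setoid c ℓ
  open Setoid vertices public using (_≈_) renaming (Carrier to Vertex)
  field
    Edge        : Rel Vertex e
    Edge-resp-≈ : Edge Respects₂ _≈_
    colour      : Vertex → Fin k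
    colour-cong : ∀ {u v} → u ≈ v → colour u ≡ colour v

record GraphSymmetry {k} (G : ColouredGraph k c ℓ e) : Set (c ⊔ ℓ ⊔ e) where
  open ColouredGraph G
  field
    permutation : Permutation vertices
  open Inverse permutation public using (to; from)
  field
    edge⇔       : ∀ u v → Edge u v ⇔ Edge (to u) (to v)
    colour≡     : ∀ v → colour (to v) ≡ colour v

graphSymmetries : ∀ {k} → ColouredGraph k c ℓ e → Setoid (c ⊔ ℓ ⊔ e) (c ⊔ ℓ)
graphSymmetries G =
  On.setoid (permutationSetoid (ColouredGraph.vertices G))
            (GraphSymmetry.permutation {G = G})

------------------------------------------------------------------------
-- Disjunctive logic programs over a set 𝒜 of atoms

module _ {a : Level} (𝒜 : Set a) where

  infix 5 ∼_
  infix 4 _←_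

  data Literal : Set a where
    pos : 𝒜 → Literal
    ∼_  : 𝒜 → Literal

  record Rule : Set a where
    constructor _←_
    field
      head : List 𝒜
      body : List Literal

  -- Heads and bodies are sets, so rules are compared by set equality of
  -- their heads and of their bodies, ignoring order and repetition.

  rules : Setoid a a
  rules = On.setoid (×-setoid ([ set ]-Equality 𝒜) ([ set ]-Equality Literal))
                    (λ r → Rule.head r , Rule.body r)

  -- A program is a finite set of rules: the lists below are only ever
  -- inspected through the membership relation _∈ᴾ_.

  Program : Set a
  Program = List Rule

module _ {a : Level} {𝒜 : Set a} where

  open Rule

  infix 4 _≈ᴿ_ _∈ᴾ_ _≈ᴾ_

  _≈ᴿ_ : Rel (Rule 𝒜) a
  _≈ᴿ_ = Setoid._≈_ (rules 𝒜)

  _∈ᴾ_ : Rule 𝒜 → Program 𝒜 → Set a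
  _∈ᴾ_ = ∈ₛ._∈_ (rules 𝒜)

  _≈ᴾ_ : Rel (Program 𝒜) a
  P ≈ᴾ Q = ∀ r → r ∈ᴾ P ⇔ r ∈ᴾ Q

  data OccursInRule (x : 𝒜) (r : Rule 𝒜) : Set a where
    inHead  : x ∈ head r       → OccursInRule x r
    inBody⁺ : pos x ∈ body r   → OccursInRule x r
    inBody⁻ : ∼ x ∈ body r     → OccursInRule x r

  Occurs : 𝒜 → Program 𝒜 → Set a
  Occurs x P = ∃ λ r → r ∈ᴾ P × OccursInRule x r

  -- atom(P) as a subset of 𝒜: the proof of occurrence is irrelevant for
  -- equality.

  atoms : Program 𝒜 → Setoid a a
  atoms P = On.setoid {B = Σ 𝒜 (λ x → Occurs x P)} (≡.setoid 𝒜) proj₁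

  Atom : Program 𝒜 → Set a
  Atom P = Setoid.Carrier (atoms P)

  ----------------------------------------------------------------------
  -- Renaming.  A permutation π of atom(P) is defined only on atoms of P,
  -- hence renaming a rule requires that all its atoms occur in P.

  renameRule : (r : Rule 𝒜) → (∀ x → OccursInRule x r → 𝒜) → Rule 𝒜
  renameRule r f =
    mapWith∈ (head r) (λ {x} x∈ → f x (inHead x∈)) ←
    mapWith∈ (body r) λ { {pos x} x∈ → pos (f x (inBody⁺ x∈))
                        ; {∼ x}   x∈ → ∼ f x (inBody⁻ x∈) }

  permuteRule : (P : Program 𝒜) → Permutation (atoms P) →
                (r : Rule 𝒜) → r ∈ᴾ P → Rule 𝒜
  permuteRule P π r r∈P =
    renameRule r (λ x x∈r → proj₁ (Inverse.to π (x , r , r∈P , x∈r)))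

  permuteProgram : (P : Program 𝒜) → Permutation (atoms P) → Program 𝒜
  permuteProgram P π =
    ∈ₛ.mapWith∈ (rules 𝒜) P (λ {r} r∈P → permuteRule P π r r∈P)

  record ProgramSymmetry (P : Program 𝒜) : Set a where
    field
      permutation : Permutation (atoms P)
      invariant   : permuteProgram P permutation ≈ᴾ P
    open Inverse permutation public using (to; from)

  programSymmetries : Program 𝒜 → Setoid a a
  programSymmetries P =
    On.setoid (permutationSetoid (atoms P)) (ProgramSymmetry.permutation {P})

  ----------------------------------------------------------------------
  -- The 3-coloured graph encoding

  module Encoding (P : Program 𝒜) where

    data Vertex : Set a where
      pos : Atom P → Vertex
      neg : Atom P → Vertex
      β   : (r : Rule 𝒜) → r ∈ᴾ P → Vertex

    infix 4 _≈ⱽ_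

    data _≈ⱽ_ : Rel Vertex a where
      pos : ∀ {x y} → proj₁ x ≡ proj₁ y → pos x ≈ⱽ pos y
      neg : ∀ {x y} → proj₁ x ≡ proj₁ y → neg x ≈ⱽ neg y
      β   : ∀ {r s r∈P s∈P} → r ≈ᴿ s → β r r∈P ≈ⱽ β s s∈P

    data Edge : Rel Vertex a where
      body⁺ : ∀ {x r r∈P} → pos (proj₁ x) ∈ body r → Edge (pos x) (β r r∈P)
      body⁻ : ∀ {x r r∈P} → (∼ proj₁ x) ∈ body r   → Edge (neg x) (β r r∈P)
      head⁺ : ∀ {x r r∈P} → proj₁ x ∈ head r       → Edge (β r r∈P) (pos x)
      link  : ∀ {x y}     → proj₁ x ≡ proj₁ y         → Edge (pos x) (neg y)

    -- The colours 1, 2, 3 are 0F, 1F, 2F.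

    colour : Vertex → Fin 3
    colour (pos _) = 0F
    colour (neg _) = 1F
    colour (β _ _) = 2F

    vertices : Setoid a a
    vertices = record
      { Carrier       = Vertex
      ; _≈_           = _≈ⱽ_
      ; isEquivalence = record
        { refl  = λ { {pos _} → pos refl
                    ; {neg _} → neg refl
                    ; {β r _} → β (R.refl {r}) }
        ; sym   = λ { (pos p) → pos (≡.sym p)
                    ; (neg p) → neg (≡.sym p)
                    ; (β {r} {s} p) → β (R.sym {r} {s} p) }
        ; trans = λ { (pos p) (pos q) → pos (≡.trans p q)
                    ; (neg p) (neg q) → neg (≡.trans p q)
                    ; (β {r} {s} p) (β {s = t} q) → β (R.trans {r} {s} {t} p q) }
        }
      }
      where module R = Setoid (rules 𝒜)

    Edge-resp-≈ : Edge Respects₂ _≈ⱽ_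
    Edge-resp-≈ = respʳ , respˡ
      where
      open Equivalence using (to)

      respʳ : ∀ {u v w} → v ≈ⱽ w → Edge u v → Edge u w
      respʳ (β r≈s)    (body⁺ x∈) = body⁺ (to (proj₂ r≈s) x∈)
      respʳ (β r≈s)    (body⁻ x∈) = body⁻ (to (proj₂ r≈s) x∈)
      respʳ (pos refl) (head⁺ x∈) = head⁺ x∈
      respʳ (neg y≡z)  (link x≡y) = link (≡.trans x≡y y≡z)

      respˡ : ∀ {w u v} → u ≈ⱽ v → Edge u w → Edge v w
      respˡ (pos refl) (body⁺ x∈) = body⁺ x∈
      respˡ (neg refl) (body⁻ x∈) = body⁻ x∈
      respˡ (β r≈s)    (head⁺ x∈) = head⁺ (to (proj₁ r≈s) x∈)
      respˡ (pos x≡y)  (link x≡z) = link (≡.trans (≡.sym x≡y) x≡z)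

    colour-cong : ∀ {u v} → u ≈ⱽ v → colour u ≡ colour v
    colour-cong (pos _) = refl
    colour-cong (neg _) = refl
    colour-cong (β _)   = refl

  encoding : Program 𝒜 → ColouredGraph 3 a a a
  encoding P = record { Encoding P }

  positive : (P : Program 𝒜) → Atom P → ColouredGraph.Vertex (encoding P)
  positive P = Encoding.Vertex.pos

{-# OPTIONS --safe #-}
-- A symmetry σ of the graph preserves colours, so it acts on positive literal
-- vertices as a permutation π of the atoms; the edges a → ∼a force the same
-- action on negative ones, and the edges at body vertices force σ(β_r) = β_s
-- with s = r^π.  Hence π is a symmetry of P and determines σ.  Conversely, a
-- symmetry π of P defines σ by β_r ↦ β_{r^π}; the inverse on body vertices is
-- read off from P ⊆ P^π, and is unique since r ↦ r^π is injective.

module Submission where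

open import Defs
open import Data.Fin.Patterns using (0F; 2F)
open import Data.List.Base using (_∷_)
open import Data.List.Membership.Propositional using (_∈_)
import Data.List.Membership.Setoid as ∈ₛ
open import Data.List.Relation.Unary.Any using (here; there)
open import Data.List.Relation.Unary.Any.Properties using (mapWith∈⁺; mapWith∈⁻)
open import Data.Product.Base using (Σ-syntax; ∃; ∃₂; _×_; _,_; proj₁; proj₂)
open import Function.Base using (_∘_)
open import Function.Bundles using (Bijection; Equivalence; Inverse; _⇔_; mk⇔)
open import Level using (Level)
open import Relation.Binary.Bundles using (Setoid)
open import Relation.Binary.PropositionalEquality using (_≡_; refl; sym; trans; cong; subst)

open Equivalence using () renaming (to to ⇒; from to ⇐)

-- Mapping over lists with membership taken up to a setoid equality.

module _ {c ℓ c′ ℓ′} (S : Setoid c ℓ) (T : Setoid c′ ℓ′) where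
  private
    module S = Setoid S
    module T = Setoid T
    module ∈S = ∈ₛ S
    module ∈T = ∈ₛ T

  -- Membership only makes `x` equivalent to an entry, while the mapped list applies `f` to the
  -- entry itself; `f-cong` bridges both this gap and the change of membership proof.
  ∈-mapWith∈⁺ : ∀ {xs} (f : ∀ {x} → x ∈S.∈ xs → T.Carrier) →
                (∀ {x y} (x∈ : x ∈S.∈ xs) (y∈ : y ∈S.∈ xs) →
                  x S.≈ y → f x∈ T.≈ f y∈) →
                ∀ {x} (x∈ : x ∈S.∈ xs) → f x∈ ∈T.∈ ∈S.mapWith∈ xs f
  ∈-mapWith∈⁺ f f-cong (here x≈)  = here (f-cong (here x≈) (here S.refl) x≈)
  ∈-mapWith∈⁺ f f-cong (there x∈) =
    there (∈-mapWith∈⁺ (f ∘ there) (λ x∈ y∈ → f-cong (there x∈) (there y∈)) x∈)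

  ∈-mapWith∈⁻ : ∀ xs (f : ∀ {x} → x ∈S.∈ xs → T.Carrier) {y} →
                y ∈T.∈ ∈S.mapWith∈ xs f →
                ∃₂ λ x (x∈ : x ∈S.∈ xs) → y T.≈ f x∈
  ∈-mapWith∈⁻ (x ∷ xs) f (here y≈)  = x , here S.refl , y≈
  ∈-mapWith∈⁻ (_ ∷ xs) f (there y∈) with ∈-mapWith∈⁻ xs (f ∘ there) y∈
  ... | x , x∈ , y≈ = x , there x∈ , y≈

-- Rules as triples of occurrence sets: head, positive body, negative body.

data Place : Set where
  head body⁺ body⁻ : Place

module _ {a : Level} {𝒜 : Set a} where

  private
    module R = Setoid (rules 𝒜)

  At : Place → Rule 𝒜 → 𝒜 → Set a
  At head  r x = x ∈ Rule.head r
  At body⁺ r x = pos x ∈ Rule.body r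
  At body⁻ r x = (∼ x) ∈ Rule.body r

  at⇒occurs : ∀ p {r x} → At p r x → OccursInRule x r
  at⇒occurs head  = inHead
  at⇒occurs body⁺ = inBody⁺
  at⇒occurs body⁻ = inBody⁻

  at⇒atom : ∀ {P r} → r ∈ᴾ P → ∀ p {x} → At p r x → Occurs x P
  at⇒atom {r = r} r∈P p x∈ = r , r∈P , at⇒occurs p x∈

  ≈ᴿ⇒at : ∀ r s → r ≈ᴿ s → ∀ p {x} → At p r x → At p s x
  ≈ᴿ⇒at _ _ r≈s head  = ⇒ (proj₁ r≈s)
  ≈ᴿ⇒at _ _ r≈s body⁺ = ⇒ (proj₂ r≈s)
  ≈ᴿ⇒at _ _ r≈s body⁻ = ⇒ (proj₂ r≈s)

  -- Every literal is either `pos x` or `∼ x`, so the two body places together exhaust the body.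
  at⇒≈ᴿ : ∀ r s → (∀ p {x} → At p r x → At p s x) →
          (∀ p {x} → At p s x → At p r x) → r ≈ᴿ s
  at⇒≈ᴿ r s r⊆s s⊆r = mk⇔ (r⊆s head) (s⊆r head) , mk⇔ (body r⊆s) (body s⊆r)
    where
    body : ∀ {r s} → (∀ p {x} → At p r x → At p s x) →
           ∀ {l} → l ∈ Rule.body r → l ∈ Rule.body s
    body r⊆s {pos _} = r⊆s body⁺
    body r⊆s {∼ _}   = r⊆s body⁻

  -- The action of a permutation of the atoms on rules and programs.

  module _ (P : Program 𝒜) where

    Perm : Set a
    Perm = Permutation (atoms P)

    to-injective : (π : Perm) → ∀ {x y} →
                   proj₁ (Inverse.to π x) ≡ proj₁ (Inverse.to π y) → proj₁ x ≡ proj₁ y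
    to-injective π {x} {y} πx≡πy =
      trans (sym (Inverse.strictlyInverseʳ π x)) (Inverse.inverseʳ π {y} {Inverse.to π x} πx≡πy)

    -- The atom `x` brings its own proof of occurrence, whereas renaming builds one from `r∈P`.
    -- Equality of atoms ignores these proofs, so `to-cong` at `refl` identifies the two images.
    at-permute⁺ : (π : Perm) → ∀ {r} (r∈P : r ∈ᴾ P) p (x : Atom P) →
                  At p r (proj₁ x) → At p (permuteRule P π r r∈P) (proj₁ (Inverse.to π x))
    at-permute⁺ π r∈P head  x x∈ =
      mapWith∈⁺ _ (_ , x∈ , Inverse.to-cong π {x} {_ , at⇒atom r∈P head x∈} refl)
    at-permute⁺ π r∈P body⁺ x x∈ =
      mapWith∈⁺ _ (_ , x∈ , cong pos (Inverse.to-cong π {x} {_ , at⇒atom r∈P body⁺ x∈} refl))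
    at-permute⁺ π r∈P body⁻ x x∈ =
      mapWith∈⁺ _ (_ , x∈ , cong ∼_ (Inverse.to-cong π {x} {_ , at⇒atom r∈P body⁻ x∈} refl))

    at-permute⁻ : (π : Perm) → ∀ {r} (r∈P : r ∈ᴾ P) p {y} →
                  At p (permuteRule P π r r∈P) y →
                  ∃ λ (x : Atom P) → At p r (proj₁ x) × proj₁ (Inverse.to π x) ≡ y
    at-permute⁻ π r∈P head y∈ with mapWith∈⁻ _ _ y∈
    ... | x , x∈ , refl = (x , at⇒atom r∈P head x∈) , x∈ , refl
    at-permute⁻ π r∈P body⁺ y∈ with mapWith∈⁻ _ _ y∈
    ... | pos x , x∈ , refl = (x , at⇒atom r∈P body⁺ x∈) , x∈ , refl
    at-permute⁻ π r∈P body⁻ y∈ with mapWith∈⁻ _ _ y∈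
    ... | (∼ x) , x∈ , refl = (x , at⇒atom r∈P body⁻ x∈) , x∈ , refl

    -- Two permutations are allowed so that one lemma serves both for independence of the membership
    -- proof and for comparing the actions of two graph symmetries.
    permuteRule-cong : (π ρ : Perm) → (∀ x → proj₁ (Inverse.to π x) ≡ proj₁ (Inverse.to ρ x)) →
                       ∀ {r s} (r∈P : r ∈ᴾ P) (s∈P : s ∈ᴾ P) → r ≈ᴿ s →
                       permuteRule P π r r∈P ≈ᴿ permuteRule P ρ s s∈P
    permuteRule-cong π ρ π≗ρ {r} {s} r∈P s∈P r≈s =
      at⇒≈ᴿ (permuteRule P π r r∈P) (permuteRule P ρ s s∈P)
            (⊆ π ρ π≗ρ r∈P s∈P r≈s)
            (⊆ ρ π (sym ∘ π≗ρ) s∈P r∈P (R.sym {r} {s} r≈s))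
      where
      ⊆ : (π ρ : Perm) → (∀ x → proj₁ (Inverse.to π x) ≡ proj₁ (Inverse.to ρ x)) →
          ∀ {r s} (r∈P : r ∈ᴾ P) (s∈P : s ∈ᴾ P) → r ≈ᴿ s →
          ∀ p {x} → At p (permuteRule P π r r∈P) x → At p (permuteRule P ρ s s∈P) x
      ⊆ π ρ π≗ρ {r} {s} r∈P s∈P r≈s p y∈ with at-permute⁻ π r∈P p y∈
      ... | x , x∈ , refl = subst (At p (permuteRule P ρ s s∈P)) (sym (π≗ρ x))
                                  (at-permute⁺ ρ s∈P p x (≈ᴿ⇒at r s r≈s p x∈))

    ∈-permute⁺ : (π : Perm) → ∀ {r} (r∈P : r ∈ᴾ P) →
                 permuteRule P π r r∈P ∈ᴾ permuteProgram P π
    ∈-permute⁺ π = ∈-mapWith∈⁺ (rules 𝒜) (rules 𝒜) (λ {r} → permuteRule P π r)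
      (permuteRule-cong π π (λ _ → refl))

    ∈-permute⁻ : (π : Perm) → ∀ {s} → s ∈ᴾ permuteProgram P π →
                 ∃₂ λ r (r∈P : r ∈ᴾ P) → s ≈ᴿ permuteRule P π r r∈P
    ∈-permute⁻ π = ∈-mapWith∈⁻ (rules 𝒜) (rules 𝒜) P _

    ∈ᴾ-resp : ∀ {Q : Program 𝒜} r s → r ≈ᴿ s → r ∈ᴾ Q → s ∈ᴾ Q
    ∈ᴾ-resp r s r≈s (here {x} r≈x) = here (R.trans {s} {r} {x} (R.sym {r} {s} r≈s) r≈x)
    ∈ᴾ-resp r s r≈s (there r∈)     = there (∈ᴾ-resp r s r≈s r∈)

    -- A relational form of `s` being the image of `r` under `π`. It quantifies over atoms of `P`
    -- and so can be read off directly from the edges at two body vertices.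
    Carries : Perm → Rule 𝒜 → Rule 𝒜 → Set a
    Carries π r s = ∀ p (x : Atom P) → At p r (proj₁ x) ⇔ At p s (proj₁ (Inverse.to π x))

    permuteRule-carries : (π : Perm) → ∀ {r} (r∈P : r ∈ᴾ P) →
                          Carries π r (permuteRule P π r r∈P)
    permuteRule-carries π {r} r∈P p x = mk⇔ (at-permute⁺ π r∈P p x) reflect
      where
      reflect : At p (permuteRule P π r r∈P) (proj₁ (Inverse.to π x)) → At p r (proj₁ x)
      reflect πx∈ with at-permute⁻ π r∈P p πx∈
      ... | x′ , x′∈ , πx′≡πx = subst (At p r) (to-injective π {x′} {x} πx′≡πx) x′∈

    -- For the inclusion from right to left, `s∈P` makes each atom of `s` an atom of `P`, which
    -- therefore has a preimage under `π`.
    carries⇒permuteRule : (π : Perm) → ∀ {r s} (r∈P : r ∈ᴾ P) → s ∈ᴾ P →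
                          Carries π r s → permuteRule P π r r∈P ≈ᴿ s
    carries⇒permuteRule π {r} {s} r∈P s∈P r↦s = at⇒≈ᴿ (permuteRule P π r r∈P) s ⊆ ⊇
      where
      ⊆ : ∀ p {y} → At p (permuteRule P π r r∈P) y → At p s y
      ⊆ p y∈ with at-permute⁻ π r∈P p y∈
      ... | x , x∈ , refl = ⇒ (r↦s p x) x∈

      ⊇ : ∀ p {y} → At p s y → At p (permuteRule P π r r∈P) y
      ⊇ p {y} y∈ =
        subst (At p (permuteRule P π r r∈P)) πx≡y
          (at-permute⁺ π r∈P p x (⇐ (r↦s p x) (subst (At p s) (sym πx≡y) y∈)))
        where
        x : Atom P
        x = Inverse.from π (y , at⇒atom s∈P p y∈)
        πx≡y : proj₁ (Inverse.to π x) ≡ y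
        πx≡y = Inverse.strictlyInverseˡ π (y , at⇒atom s∈P p y∈)

    -- An occurrence in `r` is pushed forward along `π`, moved across the equality of images, and
    -- reflected back into `s` because `π` is injective on atoms.
    permuteRule-injective : (π : Perm) → ∀ {r s} (r∈P : r ∈ᴾ P) (s∈P : s ∈ᴾ P) →
                            permuteRule P π r r∈P ≈ᴿ permuteRule P π s s∈P → r ≈ᴿ s
    permuteRule-injective π {r} {s} r∈P s∈P rπ≈sπ =
      at⇒≈ᴿ r s (⊆ r∈P s∈P rπ≈sπ)
        (⊆ s∈P r∈P (R.sym {permuteRule P π r r∈P} {permuteRule P π s s∈P} rπ≈sπ))
      where
      ⊆ : ∀ {r s} (r∈P : r ∈ᴾ P) (s∈P : s ∈ᴾ P) →
          permuteRule P π r r∈P ≈ᴿ permuteRule P π s s∈P → ∀ p {x} → At p r x → At p s x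
      ⊆ {r} {s} r∈P s∈P rπ≈sπ p {x} x∈ =
        ⇐ (permuteRule-carries π s∈P p atom)
          (≈ᴿ⇒at (permuteRule P π r r∈P) (permuteRule P π s s∈P) rπ≈sπ p
            (at-permute⁺ π r∈P p atom x∈))
        where
        atom : Atom P
        atom = x , at⇒atom r∈P p x∈

    -- Reading atoms, rules and occurrences off the vertices and edges.

    private
      module E = Encoding P
      module V = Setoid E.vertices

    -- The colour is a separate equation about a variable `v`, so that `v` can be matched on even
    -- when it is later instantiated with the image of a vertex under a symmetry.
    pos-view : ∀ v → E.colour v ≡ 0F → ∃ λ x → E.pos x V.≈ v
    pos-view (E.pos x) _ = x , V.refl

    β-view : ∀ v → E.colour v ≡ 2F → ∃₂ λ r r∈P → v V.≈ E.β r r∈P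
    β-view (E.β r r∈P) _ = r , r∈P , V.refl {E.β r r∈P}

    pos-injective : ∀ {x y} → E.pos x V.≈ E.pos y → proj₁ x ≡ proj₁ y
    pos-injective (E.pos x≡y) = x≡y

    β-injective : ∀ {r s r∈P s∈P} → E.β r r∈P V.≈ E.β s s∈P → r ≈ᴿ s
    β-injective (E.β r≈s) = r≈s

    Edge-resp : ∀ {u u′ v v′} → u V.≈ u′ → v V.≈ v′ → E.Edge u v → E.Edge u′ v′
    Edge-resp u≈ v≈ e = proj₁ E.Edge-resp-≈ v≈ (proj₂ E.Edge-resp-≈ u≈ e)

    PlaceEdge : Place → Atom P → E.Vertex → Set a
    PlaceEdge head  x v = E.Edge v (E.pos x)
    PlaceEdge body⁺ x v = E.Edge (E.pos x) v
    PlaceEdge body⁻ x v = E.Edge (E.neg x) v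

    at⇔edge : ∀ p {x r} {r∈P : r ∈ᴾ P} → At p r (proj₁ x) ⇔ PlaceEdge p x (E.β r r∈P)
    at⇔edge head  = mk⇔ E.head⁺ λ { (E.head⁺ x∈) → x∈ }
    at⇔edge body⁺ = mk⇔ E.body⁺ λ { (E.body⁺ x∈) → x∈ }
    at⇔edge body⁻ = mk⇔ E.body⁻ λ { (E.body⁻ x∈) → x∈ }

    -- From a graph symmetry to a program symmetry.

    module FromGraph (σ : GraphSymmetry (encoding P)) where
      open GraphSymmetry σ
      private
        module I = Inverse permutation

      colour-from : ∀ v → E.colour (from v) ≡ E.colour v
      colour-from v = trans (sym (colour≡ (from v))) (E.colour-cong (I.strictlyInverseˡ v))

      atomTo atomFrom : Atom P → Atom P
      atomTo   x = proj₁ (pos-view (to (E.pos x)) (colour≡ _))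
      atomFrom x = proj₁ (pos-view (from (E.pos x)) (colour-from _))

      pos-atomTo : ∀ x → E.pos (atomTo x) V.≈ to (E.pos x)
      pos-atomTo x = proj₂ (pos-view (to (E.pos x)) (colour≡ _))

      pos-atomFrom : ∀ x → E.pos (atomFrom x) V.≈ from (E.pos x)
      pos-atomFrom x = proj₂ (pos-view (from (E.pos x)) (colour-from _))

      atomPermutation : Perm
      atomPermutation = record
        { to        = atomTo
        ; from      = atomFrom
        ; to-cong   = λ {x} {y} x≡y → pos-injective
            (V.trans (pos-atomTo x) (V.trans (I.to-cong (E.pos x≡y)) (V.sym (pos-atomTo y))))
        ; from-cong = λ {x} {y} x≡y → pos-injective
            (V.trans (pos-atomFrom x) (V.trans (I.from-cong (E.pos x≡y)) (V.sym (pos-atomFrom y))))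
        ; inverse   =
            (λ {x} {y} y≡ → pos-injective
              (V.trans (pos-atomTo y) (I.inverseˡ (V.trans (E.pos y≡) (pos-atomFrom x)))))
          , (λ {x} {y} y≡ → pos-injective
              (V.trans (pos-atomFrom y) (I.inverseʳ (V.trans (E.pos y≡) (pos-atomTo x)))))
        }

      -- The link from `E.pos x` to `E.neg x` is mapped to an edge leaving `E.pos (atomTo x)`. Its
      -- target has the colour of negative vertices, so this edge is again a link and determines the
      -- target.
      neg-atomTo : ∀ x → E.neg (atomTo x) V.≈ to (E.neg x)
      neg-atomTo x = linked (to (E.neg x)) (colour≡ (E.neg x))
        (Edge-resp (V.sym (pos-atomTo x)) V.refl (⇒ (edge⇔ (E.pos x) (E.neg x)) (E.link refl)))
        where
        linked : ∀ v → E.colour v ≡ E.colour (E.neg x) →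
                 E.Edge (E.pos (atomTo x)) v → E.neg (atomTo x) V.≈ v
        linked (E.neg _) _ (E.link eq) = E.neg eq

      placeEdge⇔ : ∀ p x v → PlaceEdge p x v ⇔ PlaceEdge p (atomTo x) (to v)
      placeEdge⇔ head x v = mk⇔
        (Edge-resp V.refl (V.sym (pos-atomTo x)) ∘ ⇒ (edge⇔ v (E.pos x)))
        (⇐ (edge⇔ v (E.pos x)) ∘ Edge-resp V.refl (pos-atomTo x))
      placeEdge⇔ body⁺ x v = mk⇔
        (Edge-resp (V.sym (pos-atomTo x)) V.refl ∘ ⇒ (edge⇔ (E.pos x) v))
        (⇐ (edge⇔ (E.pos x) v) ∘ Edge-resp (pos-atomTo x) V.refl)
      placeEdge⇔ body⁻ x v = mk⇔
        (Edge-resp (V.sym (neg-atomTo x)) V.refl ∘ ⇒ (edge⇔ (E.neg x) v))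
        (⇐ (edge⇔ (E.neg x) v) ∘ Edge-resp (neg-atomTo x) V.refl)

      PlaceEdge-resp : ∀ p {x u v} → u V.≈ v → PlaceEdge p x u → PlaceEdge p x v
      PlaceEdge-resp head  u≈v = Edge-resp u≈v V.refl
      PlaceEdge-resp body⁺ u≈v = Edge-resp V.refl u≈v
      PlaceEdge-resp body⁻ u≈v = Edge-resp V.refl u≈v

      -- The edges at a body vertex record all occurrences in its rule, and the symmetry transports
      -- the edges at `E.β r r∈P` to those at `E.β s s∈P`.
      to-β : ∀ {r s} {r∈P : r ∈ᴾ P} {s∈P : s ∈ᴾ P} → to (E.β r r∈P) V.≈ E.β s s∈P →
             permuteRule P atomPermutation r r∈P ≈ᴿ s
      to-β {r} {s} {r∈P} {s∈P} σβ≈ = carries⇒permuteRule atomPermutation r∈P s∈P λ p x → mk⇔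
        (⇐ (at⇔edge p) ∘ PlaceEdge-resp p σβ≈ ∘ ⇒ (placeEdge⇔ p x (E.β r r∈P)) ∘ ⇒ (at⇔edge p))
        (⇐ (at⇔edge p) ∘ ⇐ (placeEdge⇔ p x (E.β r r∈P)) ∘ PlaceEdge-resp p (V.sym σβ≈) ∘ ⇒ (at⇔edge p))

      programSymmetry : ProgramSymmetry P
      programSymmetry = record
        { permutation = π
        ; invariant   = λ r → mk⇔ ⊆ (⊇ {r})
        }
        where
        π = atomPermutation

        ⊆ : ∀ {s} → s ∈ᴾ permuteProgram P π → s ∈ᴾ P
        ⊆ {s} s∈ with ∈-permute⁻ π s∈
        -- The image of the body vertex of `r` is the body vertex of some `t` in `P`, and `to-β`
        -- identifies `t` with the renamed `r`.
        ... | r , r∈P , s≈rπ with β-view (to (E.β r r∈P)) (colour≡ (E.β r r∈P))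
        ...   | t , t∈P , σβ≈ =
          ∈ᴾ-resp t s (R.sym {s} {t} (R.trans {s} {permuteRule P π r r∈P} {t} s≈rπ (to-β σβ≈))) t∈P

        ⊇ : ∀ {s} → s ∈ᴾ P → s ∈ᴾ permuteProgram P π
        -- The rule whose renaming is `s` is found by applying the inverse symmetry to the body
        -- vertex of `s`.
        ⊇ {s} s∈P with β-view (from (E.β s s∈P)) (colour-from (E.β s s∈P))
        ... | r , r∈P , σ⁻β≈ =
          ∈ᴾ-resp (permuteRule P π r r∈P) s (to-β (I.inverseˡ {E.β s s∈P} (V.sym σ⁻β≈)))
            (∈-permute⁺ π r∈P)

    -- From a program symmetry to a graph symmetry.

    module FromProgram (τ : ProgramSymmetry P) where
      open ProgramSymmetry τ renaming (permutation to π)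
      private
        module π = Inverse π

      image : ∀ r → r ∈ᴾ P → Rule 𝒜
      image = permuteRule P π

      image∈P : ∀ {r} (r∈P : r ∈ᴾ P) → image r r∈P ∈ᴾ P
      image∈P {r} r∈P = ⇒ (invariant (image r r∈P)) (∈-permute⁺ π r∈P)

      preimage : ∀ {s} → s ∈ᴾ P → ∃₂ λ r (r∈P : r ∈ᴾ P) → s ≈ᴿ image r r∈P
      preimage {s} s∈P = ∈-permute⁻ π (⇐ (invariant s) s∈P)

      vertexTo vertexFrom : E.Vertex → E.Vertex
      vertexTo (E.pos x)     = E.pos (π.to x)
      vertexTo (E.neg x)     = E.neg (π.to x)
      vertexTo (E.β r r∈P)   = E.β (image r r∈P) (image∈P r∈P)
      vertexFrom (E.pos x)   = E.pos (π.from x)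
      vertexFrom (E.neg x)   = E.neg (π.from x)
      vertexFrom (E.β s s∈P) = E.β (proj₁ (preimage s∈P)) (proj₁ (proj₂ (preimage s∈P)))

      vertexTo-cong : ∀ {u v} → u V.≈ v → vertexTo u V.≈ vertexTo v
      vertexTo-cong (E.pos {x} {y} x≡y) = E.pos (π.to-cong {x} {y} x≡y)
      vertexTo-cong (E.neg {x} {y} x≡y) = E.neg (π.to-cong {x} {y} x≡y)
      vertexTo-cong (E.β {r∈P = r∈P} {s∈P} r≈s) =
        E.β (permuteRule-cong π π (λ _ → refl) r∈P s∈P r≈s)

      -- Together with `vertexTo-vertexFrom` this yields congruence of `vertexFrom` and the other
      -- inverse law, without inspecting which preimage rule was chosen.
      vertexTo-injective : ∀ {u v} → vertexTo u V.≈ vertexTo v → u V.≈ v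
      vertexTo-injective {E.pos x} {E.pos y} (E.pos eq) = E.pos (to-injective π {x} {y} eq)
      vertexTo-injective {E.neg x} {E.neg y} (E.neg eq) = E.neg (to-injective π {x} {y} eq)
      vertexTo-injective {E.β _ r∈P} {E.β _ s∈P} (E.β eq) =
        E.β (permuteRule-injective π r∈P s∈P eq)

      vertexTo-vertexFrom : ∀ v → vertexTo (vertexFrom v) V.≈ v
      vertexTo-vertexFrom (E.pos x) = E.pos (π.strictlyInverseˡ x)
      vertexTo-vertexFrom (E.neg x) = E.neg (π.strictlyInverseˡ x)
      vertexTo-vertexFrom (E.β s s∈P) with preimage s∈P
      ... | r , r∈P , s≈ = E.β (R.sym {s} {image r r∈P} s≈)

      vertexPermutation : Permutation E.vertices
      vertexPermutation = record
        { to        = vertexTo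
        ; from      = vertexFrom
        ; to-cong   = vertexTo-cong
        ; from-cong = λ {u} {v} u≈v → vertexTo-injective
            (V.trans (vertexTo-vertexFrom u) (V.trans u≈v (V.sym (vertexTo-vertexFrom v))))
        ; inverse   =
            (λ {u} v≈ → V.trans (vertexTo-cong v≈) (vertexTo-vertexFrom u))
          , (λ {u} {v} v≈ → vertexTo-injective (V.trans (vertexTo-vertexFrom v) v≈))
        }

      edge⁺ : ∀ {u v} → E.Edge u v → E.Edge (vertexTo u) (vertexTo v)
      edge⁺ (E.body⁺ {x} {r∈P = r∈P} x∈) = E.body⁺ (at-permute⁺ π r∈P body⁺ x x∈)
      edge⁺ (E.body⁻ {x} {r∈P = r∈P} x∈) = E.body⁻ (at-permute⁺ π r∈P body⁻ x x∈)
      edge⁺ (E.head⁺ {x} {r∈P = r∈P} x∈) = E.head⁺ (at-permute⁺ π r∈P head x x∈)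
      edge⁺ (E.link {x} {y} x≡y)         = E.link (π.to-cong {x} {y} x≡y)

      -- Both vertices are matched first, so that `vertexTo` reduces and the edge constructors can
      -- be analysed.
      edge⁻ : ∀ u v → E.Edge (vertexTo u) (vertexTo v) → E.Edge u v
      edge⁻ (E.pos x) (E.β _ r∈P) (E.body⁺ e) = E.body⁺ (⇐ (permuteRule-carries π r∈P body⁺ x) e)
      edge⁻ (E.neg x) (E.β _ r∈P) (E.body⁻ e) = E.body⁻ (⇐ (permuteRule-carries π r∈P body⁻ x) e)
      edge⁻ (E.β _ r∈P) (E.pos x) (E.head⁺ e) = E.head⁺ (⇐ (permuteRule-carries π r∈P head x) e)
      edge⁻ (E.pos x) (E.neg y)   (E.link e)  = E.link (to-injective π {x} {y} e)

      graphSymmetry : GraphSymmetry (encoding P)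
      graphSymmetry = record
        { permutation = vertexPermutation
        ; edge⇔       = λ u v → mk⇔ edge⁺ (edge⁻ u v)
        ; colour≡     = λ { (E.pos _) → refl ; (E.neg _) → refl ; (E.β _ _) → refl }
        }

    -- The one-to-one correspondence.

    module _ (σ τ : GraphSymmetry (encoding P)) where
      private
        module σ = GraphSymmetry σ
        module τ = GraphSymmetry τ
        module Fσ = FromGraph σ
        module Fτ = FromGraph τ

      programSymmetry-injective : (∀ x → proj₁ (Fσ.atomTo x) ≡ proj₁ (Fτ.atomTo x)) →
                                  ∀ v → σ.to v V.≈ τ.to v
      programSymmetry-injective eq (E.pos x) =
        V.trans (V.sym (Fσ.pos-atomTo x)) (V.trans (E.pos (eq x)) (Fτ.pos-atomTo x))
      programSymmetry-injective eq (E.neg x) =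
        V.trans (V.sym (Fσ.neg-atomTo x)) (V.trans (E.neg (eq x)) (Fτ.neg-atomTo x))
      programSymmetry-injective eq (E.β r r∈P)
        with β-view (σ.to (E.β r r∈P)) (σ.colour≡ (E.β r r∈P))
           | β-view (τ.to (E.β r r∈P)) (τ.colour≡ (E.β r r∈P))
      ... | s , s∈P , σβ≈ | t , t∈P , τβ≈ =
        V.trans σβ≈ (V.trans (E.β s≈t) (V.sym τβ≈))
        where
        rσ rτ : Rule 𝒜
        rσ = permuteRule P Fσ.atomPermutation r r∈P
        rτ = permuteRule P Fτ.atomPermutation r r∈P
        -- Both `s` and `t` are renamings of the same `r`, by atom permutations that agree
        -- pointwise.
        s≈t : s ≈ᴿ t
        s≈t = R.trans {s} {rσ} {t} (R.sym {rσ} {s} (Fσ.to-β σβ≈))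
          (R.trans {rσ} {rτ} {t}
            (permuteRule-cong Fσ.atomPermutation Fτ.atomPermutation eq r∈P r∈P (R.refl {r}))
            (Fτ.to-β τβ≈))

    symmetryBijection : Bijection (graphSymmetries (encoding P)) (programSymmetries P)
    symmetryBijection = record
      { to        = FromGraph.programSymmetry
      ; cong      = λ {σ} {τ} → action-cong {σ} {τ}
      ; bijective =
          (λ {σ} {τ} → programSymmetry-injective σ τ)
        -- Surjectivity is required for every `σ` equal to the chosen preimage, so `σ≈` is evaluated
        -- at the positive vertices, where that preimage acts as `τ` does.
        , λ τ → FromProgram.graphSymmetry τ , λ {σ} σ≈ x → pos-injective
            (V.trans (FromGraph.pos-atomTo σ x) (σ≈ (E.pos x)))
      }
      where
      action-cong : ∀ {σ τ : GraphSymmetry (encoding P)} →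
                    (∀ v → GraphSymmetry.to σ v V.≈ GraphSymmetry.to τ v) →
                    ∀ x → proj₁ (FromGraph.atomTo σ x) ≡ proj₁ (FromGraph.atomTo τ x)
      action-cong {σ} {τ} σ≈τ x = pos-injective
        (V.trans (FromGraph.pos-atomTo σ x)
          (V.trans (σ≈τ (E.pos x)) (V.sym (FromGraph.pos-atomTo τ x))))

theorem4p1 : {a : Level} {𝒜 : Set a} (P : Program 𝒜) →
    let open ColouredGraph (encoding P) using (_≈_) in
    Σ[ φ ∈ Bijection (graphSymmetries (encoding P)) (programSymmetries P) ]
    ((σ : GraphSymmetry (encoding P)) (x : Atom P) →
    GraphSymmetry.to σ (positive P x) ≈
    positive P (ProgramSymmetry.to (Bijection.to φ σ) x))
theorem4p1 P = symmetryBijection P , λ σ x →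
  Setoid.sym (Encoding.vertices P) (FromGraph.pos-atomTo P σ x)
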